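{- Let $n\geq 1$ be an integer and let $p$ be a prime. Then there exists a finite field with exactly $p^{n}$ elements. -}

module Defs where

open import Algebra.Bundles using (CommutativeRing)
import Algebra.Definitions as AlgebraDefinitions
open import Data.Fin.Base using (Fin)
open import Data.Nat.Base using (ℕ)
open import Function.Bundles using (Inverse)
open import Level using (Level; _⊔_; suc)
open import Relation.Binary.Bundles using (Setoid)
open import Relation.Binary.PropositionalEquality using (setoid)
open import Relation.Nullary.Negation using (¬_)

-- The textbook notion of a field, with "nonzero" read as the negation of _≈_.
-- No apartness relation is part of the structure, unlike in
-- Algebra.Apartness.Bundles.HeytingField.
record Field (c ℓ : Level) : Set (suc (c ⊔ ℓ)) where
  field
    commutativeRing : CommutativeRing c ℓ

  open CommutativeRing commutativeRing public
  open AlgebraDefinitions _≈_ using (Invertible)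

  field
    0≉1        : ¬ (0# ≈ 1#)
    invertible : ∀ x → ¬ (x ≈ 0#) → Invertible 1# _*_ x

-- Elements are counted up to the setoid equality: the inverse maps respect _≈_
-- on the left and propositional equality on Fin n.
HasCardinality : ∀ {c ℓ} → Setoid c ℓ → ℕ → Set (c ⊔ ℓ)
HasCardinality S n = Inverse S (setoid (Fin n))

{-# OPTIONS --safe #-}

-- Let q = pⁿ and N = q - 1. In the group ring R = 𝔽ₚ[ℤ/N], generated by X with
-- X^N = 1, every element satisfies f^q = f, since this holds for monomials and
-- f ↦ f^q is additive. The element a = ∏_{0<i<n} (X^(p^i) - X) of R is nonzero,
-- being the image of a monic polynomial of degree less than N. As a^q = a, it
-- becomes invertible modulo its annihilator, so in any residue field K of
-- R / Ann(a) the conjugates X^(p^i) with i < n are distinct. A polynomial of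
-- degree < n over 𝔽ₚ that vanishes at X vanishes at all of them and hence is
-- zero; thus the Σ_{i<n} cᵢ X^i with cᵢ ∈ 𝔽ₚ are pⁿ distinct elements of K.
-- There are no others, since all elements of K are roots of T^q - T.
module Submission where

open import Defs
open import Algebra.Bundles using (CommutativeRing)
import Algebra.Properties.Semiring.Exp as Exp
import Algebra.Properties.Semiring.Mult as Mult
open import Data.Fin.Base as Fin
  using (Fin; zero; suc; toℕ; inject₁; finToFun; funToFin; combine; remQuot)
import Data.Fin.Properties as Fin
open import Data.List.Base using (List; []; _∷_; _++_; map; [_]; ++-[]-rawMonoid)
open import Data.List.Properties as List using (++-assoc; ++-identityʳ; map-++)
open import Data.List.Relation.Unary.All as All using (All; []; _∷_)
import Data.List.Relation.Unary.All.Properties as All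
open import Data.Nat as ℕ
  using (ℕ; zero; suc; _≥_; _≤_; _<_; z≤n; s≤s; z<s; s<s; NonZero; _%_; _∸_; pred)
open import Data.Nat.Combinatorics using (_C_; nCk+nC[k+1]≡[n+1]C[k+1]; nCn≡1; nC1≡n)
open import Data.Nat.Coprimality using (prime⇒coprime; coprime-Bézout)
open import Data.Nat.Divisibility using (_∣_; divides; ∣⇒≤)
open import Data.Nat.DivMod
  using (m%n<n; m%n%n≡m%n; %-distribˡ-+; m<n⇒m%n≡m; n%n≡0; m*n%n≡0; [m+kn]%n≡m%n)
open import Data.Nat.GCD using (module Bézout)
open import Data.Nat.Primality using (Prime; euclidsLemma; prime⇒nonZero; prime⇒nonTrivial)
import Data.Nat.Properties as ℕ
open import Data.Nat.Tactic.RingSolver using (solve-∀)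
open import Data.Product using (Σ-syntax; ∃; _×_; _,_; proj₁; proj₂)
open import Data.Sum as Sum using (_⊎_; inj₁; inj₂)
open import Function using (_∘_; id)
open import Level using (Level; 0ℓ)
open import Relation.Binary.Definitions using (tri<; tri≈; tri>)
open import Relation.Binary.PropositionalEquality as ≡ using (_≡_; _≢_; _≗_; cong; cong₂)
open import Relation.Binary.Structures using (IsEquivalence)
open import Relation.Nullary using (¬_; Dec; yes; no; contradiction)
open import Relation.Nullary.Decidable using (map′)
open import Relation.Unary using (Pred; Decidable; _⊆_)

open import Algebra.Definitions.RawMonoid (++-[]-rawMonoid ℕ) using () renaming (_×_ to _copies_)
open import Algebra.Properties.CommutativeSemigroup ℕ.+-commutativeSemigroup
  using (interchange; xy∙z≈xz∙y)

-- Binomial coefficients at a prime.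

[1+k]*[1+n]C[1+k]≡[1+n]*nCk : ∀ n k → suc k ℕ.* (suc n C suc k) ≡ suc n ℕ.* (n C k)
[1+k]*[1+n]C[1+k]≡[1+n]*nCk n zero = begin
  1 ℕ.* (suc n C 1)  ≡⟨ ℕ.*-identityˡ _ ⟩
  suc n C 1          ≡⟨ nC1≡n (suc n) ⟩
  suc n              ≡⟨ ℕ.*-identityʳ (suc n) ⟨
  suc n ℕ.* 1        ≡⟨⟩
  suc n ℕ.* (n C 0)  ∎
  where open ≡.≡-Reasoning
[1+k]*[1+n]C[1+k]≡[1+n]*nCk zero (suc k) = ℕ.*-zeroʳ (suc (suc k))
[1+k]*[1+n]C[1+k]≡[1+n]*nCk (suc n) (suc k) = begin
  (2 ℕ.+ k) ℕ.* (suc (suc n) C suc (suc k))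
    ≡⟨ cong ((2 ℕ.+ k) ℕ.*_) (nCk+nC[k+1]≡[n+1]C[k+1] (suc n) (suc k)) ⟨
  (2 ℕ.+ k) ℕ.* (a ℕ.+ b)
    -- One copy of `a` is set aside so that the induction hypothesis fits the other `suc k` copies;
    -- it rejoins the sum at the end.
    ≡⟨ expand k a b ⟩
  a ℕ.+ (suc k ℕ.* a ℕ.+ (2 ℕ.+ k) ℕ.* b)
    ≡⟨ cong₂ (λ u v → a ℕ.+ (u ℕ.+ v)) ([1+k]*[1+n]C[1+k]≡[1+n]*nCk n k)
                                          ([1+k]*[1+n]C[1+k]≡[1+n]*nCk n (suc k)) ⟩
  a ℕ.+ (suc n ℕ.* (n C k) ℕ.+ suc n ℕ.* (n C suc k))
    ≡⟨ cong (a ℕ.+_) (ℕ.*-distribˡ-+ (suc n) (n C k) (n C suc k)) ⟨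
  a ℕ.+ suc n ℕ.* (n C k ℕ.+ n C suc k)
    ≡⟨ cong (λ u → a ℕ.+ suc n ℕ.* u) (nCk+nC[k+1]≡[n+1]C[k+1] n k) ⟩
  suc (suc n) ℕ.* a  ∎
  where
  open ≡.≡-Reasoning
  a = suc n C suc k
  b = suc n C suc (suc k)
  expand : ∀ k a b → (2 ℕ.+ k) ℕ.* (a ℕ.+ b) ≡ a ℕ.+ (suc k ℕ.* a ℕ.+ (2 ℕ.+ k) ℕ.* b)
  expand = solve-∀

-- By the absorption identity `p` divides `k * (p C k)`, and it cannot divide the smaller positive
-- number `k`.
prime∣pCk : ∀ {p k} → Prime p → 0 < k → k < p → p ∣ p C k
prime∣pCk {suc p} {suc k} pp _ k<p
  with euclidsLemma (suc k) (suc p C suc k) pp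
         (divides (p C k) (≡.trans ([1+k]*[1+n]C[1+k]≡[1+n]*nCk p k) (ℕ.*-comm (suc p) (p C k))))
... | inj₁ p∣k = contradiction (∣⇒≤ p∣k) (ℕ.<⇒≱ k<p)
... | inj₂ p∣C = p∣C

-- The Frobenius endomorphism and its iterates.

module CharacteristicP {c ℓ : Level} (R : CommutativeRing c ℓ) where

  open CommutativeRing R hiding (zero)
  open Mult semiring
    using (×-congˡ; ×-congʳ; ×-assocˡ; ×-assoc-*; ×-homo-1)
    renaming (_×_ to _×′_)
  open Exp semiring using (_^_; ^-congˡ; ^-congʳ; ^-assocʳ)
  open import Algebra.Properties.CommutativeSemiring.Exp commutativeSemiring
    using (^-distrib-*)
  open import Algebra.Properties.CommutativeSemiring.Binomial commutativeSemiring
    using (theorem; binomialTerm)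
  open import Algebra.Properties.Semiring.Sum semiring
    using (sum; sum-cong-≋; sum-replicate-zero; sum-init-last)
  open import Relation.Binary.Reasoning.Setoid setoid

  0^n≈0 : ∀ n → .{{NonZero n}} → 0# ^ n ≈ 0#
  0^n≈0 (suc n) = zeroˡ _

  1^n≈1 : ∀ n → 1# ^ n ≈ 1#
  1^n≈1 zero    = refl
  1^n≈1 (suc n) = trans (*-identityˡ _) (1^n≈1 n)

  module Frobenius {p : ℕ} (pp : Prime p) (p×1≈0 : p ×′ 1# ≈ 0#) where

    private instance
      p≢0 : NonZero p
      p≢0 = prime⇒nonZero pp

    p∣n⇒n×x≈0 : ∀ {n} x → p ∣ n → n ×′ x ≈ 0#
    p∣n⇒n×x≈0 {n} x (divides k n≡k*p) = begin
      n ×′ x                ≈⟨ ×-congˡ (≡.trans n≡k*p (ℕ.*-comm k p)) ⟩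
      (p ℕ.* k) ×′ x        ≈⟨ ×-assocˡ x p k ⟨
      p ×′ (k ×′ x)         ≈⟨ ×-congʳ p (*-identityˡ (k ×′ x)) ⟨
      p ×′ (1# * (k ×′ x))  ≈⟨ ×-assoc-* p 1# (k ×′ x) ⟨
      (p ×′ 1#) * (k ×′ x)  ≈⟨ *-congʳ p×1≈0 ⟩
      0# * (k ×′ x)         ≈⟨ zeroˡ _ ⟩
      0#                    ∎

    private
      -- The inner terms of the binomial expansion vanish because `p` divides their coefficients.
      -- Writing the exponent as `suc m` lets the first and last terms be split off the sum.
      [x+y]^[1+m]≈x^[1+m]+y^[1+m] : ∀ {m} → p ≡ suc m → ∀ x y →
        (x + y) ^ suc m ≈ x ^ suc m + y ^ suc m
      [x+y]^[1+m]≈x^[1+m]+y^[1+m] {m} ≡.refl x y = begin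
        (x + y) ^ suc m         ≈⟨ theorem (suc m) x y ⟩
        t zero + sum (t ∘ suc)  ≈⟨ +-cong t₀ (sum-init-last (t ∘ suc)) ⟩
        y ^ suc m + (sum (t ∘ suc ∘ inject₁) + t (suc (Fin.fromℕ m)))
          ≈⟨ +-congˡ (+-cong (trans (sum-cong-≋ middle) (sum-replicate-zero m)) tₚ) ⟩
        y ^ suc m + (0# + x ^ suc m)  ≈⟨ +-congˡ (+-identityˡ _) ⟩
        y ^ suc m + x ^ suc m         ≈⟨ +-comm _ _ ⟩
        x ^ suc m + y ^ suc m         ∎
        where
        t = binomialTerm x y (suc m)
        t₀ : t zero ≈ y ^ suc m
        t₀ = trans (×-homo-1 _) (*-identityˡ _)
        tₚ : t (suc (Fin.fromℕ m)) ≈ x ^ suc m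
        tₚ rewrite Fin.toℕ-fromℕ m | nCn≡1 (suc m) | ℕ.n∸n≡0 m =
          trans (×-homo-1 _) (*-identityʳ _)
        middle : ∀ (i : Fin m) → t (suc (inject₁ i)) ≈ 0#
        middle i rewrite Fin.toℕ-inject₁ i =
          p∣n⇒n×x≈0 _ (prime∣pCk pp z<s (s<s (Fin.toℕ<n i)))

    [x+y]^p≈x^p+y^p : ∀ x y → (x + y) ^ p ≈ x ^ p + y ^ p
    [x+y]^p≈x^p+y^p x y =
      ≡.subst (λ k → (x + y) ^ k ≈ x ^ k + y ^ k) (ℕ.suc-pred p)
        ([x+y]^[1+m]≈x^[1+m]+y^[1+m] (≡.sym (ℕ.suc-pred p)) x y)

    infixr 8 _^p^_
    _^p^_ : Carrier → ℕ → Carrier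
    x ^p^ m = x ^ (p ℕ.^ m)

    ^p^-cong : ∀ m {x y} → x ≈ y → x ^p^ m ≈ y ^p^ m
    ^p^-cong m = ^-congˡ (p ℕ.^ m)

    ^p^-0 : ∀ x → x ^p^ 0 ≈ x
    ^p^-0 x = *-identityʳ x

    ^p^-^p^ : ∀ x i j → (x ^p^ i) ^p^ j ≈ x ^p^ (i ℕ.+ j)
    ^p^-^p^ x i j = trans (^-assocʳ x (p ℕ.^ i) (p ℕ.^ j)) (^-congʳ x (≡.sym (ℕ.^-distribˡ-+-* p i j)))

    ^p^-suc : ∀ x m → x ^p^ suc m ≈ (x ^p^ m) ^ p
    ^p^-suc x m = trans (^-congʳ x (ℕ.*-comm p (p ℕ.^ m))) (sym (^-assocʳ x (p ℕ.^ m) p))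

    ^p^-homo-+ : ∀ m x y → (x + y) ^p^ m ≈ x ^p^ m + y ^p^ m
    ^p^-homo-+ zero    x y = trans (^p^-0 _) (sym (+-cong (^p^-0 x) (^p^-0 y)))
    ^p^-homo-+ (suc m) x y = begin
      (x + y) ^p^ suc m              ≈⟨ ^p^-suc (x + y) m ⟩
      ((x + y) ^p^ m) ^ p            ≈⟨ ^-congˡ p (^p^-homo-+ m x y) ⟩
      (x ^p^ m + y ^p^ m) ^ p        ≈⟨ [x+y]^p≈x^p+y^p _ _ ⟩
      (x ^p^ m) ^ p + (y ^p^ m) ^ p  ≈⟨ +-cong (^p^-suc x m) (^p^-suc y m) ⟨
      x ^p^ suc m + y ^p^ suc m      ∎

    ^p^-homo-* : ∀ m x y → (x * y) ^p^ m ≈ x ^p^ m * y ^p^ m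
    ^p^-homo-* m x y = ^-distrib-* x y (p ℕ.^ m)

    0^p^ : ∀ m → 0# ^p^ m ≈ 0#
    0^p^ m = 0^n≈0 (p ℕ.^ m) {{ℕ.m^n≢0 p m}}

    -- This is Fermat's little theorem in the prime subring, obtained from additivity by induction
    -- on `n`. It will let conjugation pass through polynomials with such coefficients.
    [n×1]^p^≈n×1 : ∀ m n → (n ×′ 1#) ^p^ m ≈ n ×′ 1#
    [n×1]^p^≈n×1 m zero    = 0^p^ m
    [n×1]^p^≈n×1 m (suc n) =
      trans (^p^-homo-+ m 1# (n ×′ 1#)) (+-cong (1^n≈1 (p ℕ.^ m)) ([n×1]^p^≈n×1 m n))

-- Polynomials: division by a linear factor and uniqueness of interpolation.

module Polynomial {c ℓ : Level} (R : CommutativeRing c ℓ) where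

  open CommutativeRing R hiding (zero)
  open import Algebra.Properties.AbelianGroup +-abelianGroup
    using (x∙y⁻¹≈ε⇒x≈y; //-rightDividesˡ; ∙-cancelˡ; ∙-cancelʳ)
  open import Algebra.Solver.Ring.NaturalCoefficients.Default commutativeSemiring
    using (solve; _:=_; _:+_; _:*_)
  open Exp semiring using (_^_)
  open import Relation.Binary.Reasoning.Setoid setoid

  -- A polynomial is its vector of coefficients, constant term first, so `d` is a strict bound on
  -- the degree. Evaluation is Horner's scheme.
  eval : ∀ {d} → (Fin d → Carrier) → Carrier → Carrier
  eval {zero}  f x = 0#
  eval {suc d} f x = f zero + x * eval (f ∘ suc) x

  eval-congˡ : ∀ {d} (f : Fin d → Carrier) {x y} → x ≈ y → eval f x ≈ eval f y
  eval-congˡ {zero}  f x≈y = refl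
  eval-congˡ {suc d} f x≈y = +-congˡ (*-cong x≈y (eval-congˡ (f ∘ suc) x≈y))

  -- Synthetic division: the coefficients of the quotient are the intermediate values of Horner's
  -- scheme at `r`.
  _/[X-_] : ∀ {d} → (Fin (suc d) → Carrier) → Carrier → Fin d → Carrier
  (f /[X- r ]) zero    = eval (f ∘ suc) r
  (f /[X- r ]) (suc i) = ((f ∘ suc) /[X- r ]) i

  -- This is f(x) = f(r) + (x - r) (f /[X- r ])(x), with x = t + r to avoid subtraction.
  eval-/[X-] : ∀ {d} (f : Fin (suc d) → Carrier) r t →
    eval f (t + r) ≈ eval f r + t * eval (f /[X- r ]) (t + r)
  eval-/[X-] {zero} f r t = trans (+-congˡ (trans (zeroʳ _) (sym (zeroʳ r))))
    (sym (trans (+-congˡ (zeroʳ t)) (+-identityʳ _)))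
  eval-/[X-] {suc d} f r t = begin
    f zero + (t + r) * eval (f ∘ suc) (t + r)  ≈⟨ +-congˡ (*-congˡ (eval-/[X-] (f ∘ suc) r t)) ⟩
    f zero + (t + r) * (e + t * q)             ≈⟨ rearrange (f zero) e q r t ⟩
    (f zero + r * e) + t * (e + (t + r) * q)   ∎
    where
    e = eval (f ∘ suc) r
    q = eval ((f ∘ suc) /[X- r ]) (t + r)
    rearrange : ∀ a e q r t → a + (t + r) * (e + t * q) ≈ (a + r * e) + t * (e + (t + r) * q)
    rearrange = solve 5 (λ a e q r t →
      a :+ (t :+ r) :* (e :+ t :* q) := (a :+ r :* e) :+ t :* (e :+ (t :+ r) :* q)) refl

  -- The leading entry of the quotient is the value of the tail at `r`, so Horner's scheme gives
  -- back the constant term by cancellation; the remaining coefficients follow by recursion on the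
  -- tail.
  /[X-]-injective : ∀ {d} (f g : Fin (suc d) → Carrier) r → eval f r ≈ eval g r →
    (∀ i → (f /[X- r ]) i ≈ (g /[X- r ]) i) → ∀ i → f i ≈ g i
  /[X-]-injective {zero} f g r fr≈gr q≈ zero = ∙-cancelʳ (r * 0#) _ _ fr≈gr
  /[X-]-injective {suc d} f g r fr≈gr q≈ zero =
    ∙-cancelʳ (r * eval (g ∘ suc) r) _ _ (trans (+-congˡ (*-congˡ (sym (q≈ zero)))) fr≈gr)
  /[X-]-injective {suc d} f g r fr≈gr q≈ (suc i) =
    /[X-]-injective (f ∘ suc) (g ∘ suc) r (q≈ zero) (q≈ ∘ suc) i

  -- Induction on `d`, dividing by `X - r₀`: the remainders agree, and at every other node the
  -- nonzero factor `x - r₀` cancels, so the quotients agree there. This is used both to separate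
  -- elements of the field and to bound the number of roots of a polynomial.
  interpolation-unique : (∀ x {y z} → ¬ (x ≈ 0#) → x * y ≈ x * z → y ≈ z) →
    ∀ {d} (f g r : Fin d → Carrier) → (∀ {i j} → r i ≈ r j → i ≡ j) →
    (∀ i → eval f (r i) ≈ eval g (r i)) → ∀ i → f i ≈ g i
  interpolation-unique *-cancel {suc d} f g r r-injective fr≈gr =
    /[X-]-injective f g r₀ (fr≈gr zero)
      (interpolation-unique *-cancel (f /[X- r₀ ]) (g /[X- r₀ ]) (r ∘ suc)
        (Fin.suc-injective ∘ r-injective) quotients-agree)
    where
    r₀ = r zero
    rᵢ-r₀≉0 : ∀ i → ¬ (r (suc i) - r₀ ≈ 0#)
    rᵢ-r₀≉0 i eq with r-injective (x∙y⁻¹≈ε⇒x≈y _ _ eq)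
    ... | ()
    quotients-agree : ∀ i → eval (f /[X- r₀ ]) (r (suc i)) ≈ eval (g /[X- r₀ ]) (r (suc i))
    quotients-agree i = begin
      eval (f /[X- r₀ ]) x         ≈⟨ eval-congˡ (f /[X- r₀ ]) x≈t+r₀ ⟩
      eval (f /[X- r₀ ]) (t + r₀)  ≈⟨ *-cancel t (rᵢ-r₀≉0 i) (∙-cancelˡ (eval g r₀) _ _ equal) ⟩
      eval (g /[X- r₀ ]) (t + r₀)  ≈⟨ eval-congˡ (g /[X- r₀ ]) x≈t+r₀ ⟨
      eval (g /[X- r₀ ]) x         ∎
      where
      x = r (suc i)
      t = x - r₀
      x≈t+r₀ : x ≈ t + r₀
      x≈t+r₀ = sym (//-rightDividesˡ r₀ x)
      equal : eval g r₀ + t * eval (f /[X- r₀ ]) (t + r₀) ≈ eval g r₀ + t * eval (g /[X- r₀ ]) (t + r₀)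
      equal = begin
        eval g r₀ + t * eval (f /[X- r₀ ]) (t + r₀)  ≈⟨ +-congʳ (fr≈gr zero) ⟨
        eval f r₀ + t * eval (f /[X- r₀ ]) (t + r₀)  ≈⟨ eval-/[X-] f r₀ t ⟨
        eval f (t + r₀)                              ≈⟨ eval-congˡ f x≈t+r₀ ⟨
        eval f x                                     ≈⟨ fr≈gr (suc i) ⟩
        eval g x                                     ≈⟨ eval-congˡ g x≈t+r₀ ⟩
        eval g (t + r₀)                              ≈⟨ eval-/[X-] g r₀ t ⟩
        eval g r₀ + t * eval (g /[X- r₀ ]) (t + r₀)  ∎

  monomial : ∀ {d} → Fin d → Fin d → Carrier
  monomial zero    zero    = 1#
  monomial zero    (suc _) = 0#
  monomial (suc _) zero    = 0#
  monomial (suc j) (suc i) = monomial j i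

  eval-0 : ∀ d x → eval {d} (λ _ → 0#) x ≈ 0#
  eval-0 zero    x = refl
  eval-0 (suc d) x = trans (+-identityˡ _) (trans (*-congˡ (eval-0 d x)) (zeroʳ x))

  eval-monomial : ∀ {d} (j : Fin d) x → eval (monomial j) x ≈ x ^ toℕ j
  eval-monomial {suc d} zero    x = trans (+-congˡ (trans (*-congˡ (eval-0 d x)) (zeroʳ x))) (+-identityʳ 1#)
  eval-monomial {suc d} (suc j) x = trans (+-identityˡ _) (*-congˡ (eval-monomial j x))

  monomial-diagonal : ∀ {d} (j : Fin d) → monomial j j ≡ 1#
  monomial-diagonal zero    = ≡.refl
  monomial-diagonal (suc j) = monomial-diagonal j

  monomial-off-diagonal : ∀ {d} (i j : Fin d) → i ≢ j → monomial i j ≡ 0#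
  monomial-off-diagonal zero    zero    i≢j = contradiction ≡.refl i≢j
  monomial-off-diagonal zero    (suc j) i≢j = ≡.refl
  monomial-off-diagonal (suc i) zero    i≢j = ≡.refl
  monomial-off-diagonal (suc i) (suc j) i≢j = monomial-off-diagonal i j (i≢j ∘ cong suc)

-- Ideals, quotient rings, maximal ideals and residue fields.

module Ideals {a : Level} (R : CommutativeRing a a) where

  open CommutativeRing R hiding (zero)
  open import Algebra.Properties.Ring ring using (-1*x≈-x; x[y-z]≈xy-xz; -0#≈0#; -‿distribʳ-*)
  open import Algebra.Properties.AbelianGroup +-abelianGroup
    using (⁻¹-involutive; ⁻¹-anti-homo-//; ⁻¹-∙-comm; //-rightDividesˡ)
  open import Algebra.Solver.Ring.NaturalCoefficients.Default commutativeSemiring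
    using (solve; _:=_; _:+_; _:*_)
  open Exp semiring using (_^_)
  open Mult semiring using () renaming (_×_ to _×′_)

  record Ideal : Set (Level.suc a) where
    field
      _∈I   : Pred Carrier a
      resp  : ∀ {x y} → x ≈ y → x ∈I → y ∈I
      0∈I   : 0# ∈I
      +-closed : ∀ {x y} → x ∈I → y ∈I → (x + y) ∈I
      *-closed : ∀ x {y} → y ∈I → (x * y) ∈I

    -‿closed : ∀ {x} → x ∈I → (- x) ∈I
    -‿closed {x} x∈I = resp (-1*x≈-x x) (*-closed (- 1#) x∈I)

    infix 4 _~_
    _~_ : Carrier → Carrier → Set a
    x ~ y = (x - y) ∈I

    ≈⇒~ : ∀ {x y} → x ≈ y → x ~ y
    ≈⇒~ {x} {y} x≈y = resp (sym (trans (+-congʳ x≈y) (-‿inverseʳ y))) 0∈I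

    ~-sym : ∀ {x y} → x ~ y → y ~ x
    ~-sym {x} {y} x~y = resp (⁻¹-anti-homo-// x y) (-‿closed x~y)

    ~-trans : ∀ {x y z} → x ~ y → y ~ z → x ~ z
    ~-trans {x} {y} {z} x~y y~z = resp telescope (+-closed x~y y~z)
      where
      telescope : (x - y) + (y - z) ≈ x - z
      telescope = trans (sym (+-assoc _ y (- z))) (+-congʳ (//-rightDividesˡ y x))

    ~-isEquivalence : IsEquivalence _~_
    ~-isEquivalence = record { refl = ≈⇒~ refl ; sym = ~-sym ; trans = ~-trans }

    ~-+-cong : ∀ {x y u v} → x ~ y → u ~ v → x + u ~ y + v
    ~-+-cong {x} {y} {u} {v} x~y u~v = resp rearrange (+-closed x~y u~v)
      where
      rearrange : (x - y) + (u - v) ≈ (x + u) - (y + v)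
      rearrange = trans
        (solve 4 (λ x y u v → (x :+ y) :+ (u :+ v) := (x :+ u) :+ (y :+ v)) refl x (- y) u (- v))
        (+-congˡ (⁻¹-∙-comm y v))

    ~-*-congˡ : ∀ x {u v} → u ~ v → x * u ~ x * v
    ~-*-congˡ x {u} {v} u~v = resp (x[y-z]≈xy-xz x u v) (*-closed x u~v)

    ~-*-cong : ∀ {x y u v} → x ~ y → u ~ v → x * u ~ y * v
    ~-*-cong {x} {y} {u} {v} x~y u~v =
      ~-trans (~-*-congˡ x u~v)
        (~-trans (≈⇒~ (*-comm x v)) (~-trans (~-*-congˡ v x~y) (≈⇒~ (*-comm v y))))

    ~-‿cong : ∀ {x y} → x ~ y → - x ~ - y
    ~-‿cong {x} {y} x~y = resp (sym (⁻¹-∙-comm x (- y))) (-‿closed x~y)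

    quotient : CommutativeRing a a
    quotient = record
      { Carrier = Carrier ; _≈_ = _~_ ; _+_ = _+_ ; _*_ = _*_ ; -_ = -_ ; 0# = 0# ; 1# = 1#
      ; isCommutativeRing = record
        { isRing = record
          { +-isAbelianGroup = record
            { isGroup = record
              { isMonoid = record
                { isSemigroup = record
                  { isMagma = record { isEquivalence = ~-isEquivalence ; ∙-cong = ~-+-cong }
                  ; assoc = λ x y z → ≈⇒~ (+-assoc x y z)
                  }
                ; identity = (λ x → ≈⇒~ (+-identityˡ x)) , (λ x → ≈⇒~ (+-identityʳ x))
                }
              ; inverse = (λ x → ≈⇒~ (-‿inverseˡ x)) , (λ x → ≈⇒~ (-‿inverseʳ x))
              ; ⁻¹-cong = ~-‿cong
              }
            ; comm = λ x y → ≈⇒~ (+-comm x y)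
            }
          ; *-cong = ~-*-cong
          ; *-assoc = λ x y z → ≈⇒~ (*-assoc x y z)
          ; *-identity = (λ x → ≈⇒~ (*-identityˡ x)) , (λ x → ≈⇒~ (*-identityʳ x))
          ; distrib = (λ x y z → ≈⇒~ (distribˡ x y z)) , (λ x y z → ≈⇒~ (distribʳ x y z))
          }
        ; *-comm = λ x y → ≈⇒~ (*-comm x y)
        }
      }

    -- The operations of R and of the quotient coincide, but their iterates do
    -- not unfold for a variable exponent.
    quotient-^ : ∀ n x → (Exp._^_ (CommutativeRing.semiring quotient) x n) ≡ x ^ n
    quotient-^ zero    x = ≡.refl
    quotient-^ (suc n) x = cong (x *_) (quotient-^ n x)

    quotient-× : ∀ n x → (Mult._×_ (CommutativeRing.semiring quotient) n x) ≡ n ×′ x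
    quotient-× zero    x = ≡.refl
    quotient-× (suc n) x = cong (x +_) (quotient-× n x)

    ∈I⇒~0 : ∀ {x} → x ∈I → x ~ 0#
    ∈I⇒~0 {x} = resp (trans (sym (+-identityʳ x)) (+-congˡ (sym -0#≈0#)))

    ~0⇒∈I : ∀ {x} → x ~ 0# → x ∈I
    ~0⇒∈I {x} = resp (trans (+-congˡ -0#≈0#) (+-identityʳ x))

  annihilator : Carrier → Ideal
  annihilator r = record
    { _∈I = λ x → r * x ≈ 0#
    ; resp = λ x≈y rx≈0 → trans (*-congˡ (sym x≈y)) rx≈0
    ; 0∈I = zeroʳ r
    ; +-closed = λ rx≈0 ry≈0 → trans (distribˡ r _ _) (trans (+-cong rx≈0 ry≈0) (+-identityˡ 0#))
    ; *-closed = λ x {y} ry≈0 →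
        trans (solve 3 (λ r x y → r :* (x :* y) := x :* (r :* y)) refl r x y)
          (trans (*-congˡ ry≈0) (zeroʳ x))
    }

  -- This is the ideal sum `I + (x)`: since `y` may be replaced by its negative, a plus sign serves
  -- as well as a minus sign and keeps the identities within semiring arithmetic.
  adjoin : Ideal → Carrier → Ideal
  adjoin I x = record
    { _∈I = λ z → ∃ λ y → (z + x * y) ∈I
    ; resp = λ z≈w (y , h) → y , resp (+-congʳ z≈w) h
    ; 0∈I = 0# , resp (sym (trans (+-identityˡ _) (zeroʳ x))) 0∈I
    ; +-closed = λ {z} {z′} (y , h) (y′ , h′) → y + y′ ,
        resp (solve 5 (λ x y y′ z z′ →
                (z :+ x :* y) :+ (z′ :+ x :* y′) := (z :+ z′) :+ x :* (y :+ y′)) refl x y y′ z z′)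
          (+-closed h h′)
    ; *-closed = λ w {z} (y , h) → w * y ,
        resp (solve 4 (λ x y z w → w :* (z :+ x :* y) := w :* z :+ x :* (w :* y)) refl x y z w)
          (*-closed w h)
    }
    where open Ideal I

  -- Decidable membership, together with finiteness of the ring, makes the search for a maximal
  -- ideal constructive.
  record DecidableProperIdeal : Set (Level.suc a) where
    field
      ideal  : Ideal
    open Ideal ideal public
    field
      _∈I?   : Decidable _∈I
      proper : ¬ (1# ∈I)

  open DecidableProperIdeal using (_∈I)

  -- The sign in 1# + x * y avoids subtraction: it makes - y the inverse of x.
  ZeroOrUnitModulo : DecidableProperIdeal → Carrier → Set a
  ZeroOrUnitModulo I x = (I ∈I) x ⊎ ∃ λ y → (I ∈I) (1# + x * y)

  module _ {M : ℕ} (enum : Fin M → Carrier) (enum-surjective : ∀ x → ∃ λ i → enum i ≈ x) where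

    any? : {P : Pred Carrier a} → (∀ {x y} → x ≈ y → P x → P y) → Decidable P → Dec (∃ P)
    any? P-resp P? = map′ (λ (i , Pi) → enum i , Pi)
      (λ (x , Px) → let (i , eᵢ≈x) = enum-surjective x in i , P-resp (sym eᵢ≈x) Px)
      (Fin.any? (P? ∘ enum))

    -- If `1#` lies in `J + (x)`, then `x` is already a unit modulo `J`; otherwise `J + (x)` is
    -- proper and contains `x`. Both outcomes persist when the ideal grows, so the elements treated
    -- earlier stay settled.
    enlarge : ∀ {k} (xs : Fin k → Carrier) (I : DecidableProperIdeal) →
      Σ[ J ∈ DecidableProperIdeal ] (I ∈I) ⊆ (J ∈I) × (∀ i → ZeroOrUnitModulo J (xs i))
    enlarge {zero}  xs I = I , id , λ ()
    enlarge {suc k} xs I with enlarge (xs ∘ suc) I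
    ... | J , I⊆J , tail-ok = decide (1∈adjoin? 1#)
      where
      open DecidableProperIdeal J using (ideal; _∈I?; resp; proper)
      x = xs zero
      1∈adjoin? : ∀ z → Dec (∃ λ y → (J ∈I) (z + x * y))
      1∈adjoin? z = any? (λ y≈y′ → resp (+-congˡ (*-congˡ y≈y′))) (λ y → (z + x * y) ∈I?)

      decide : Dec (∃ λ y → (J ∈I) (1# + x * y)) →
        Σ[ J ∈ DecidableProperIdeal ] (I ∈I) ⊆ (J ∈I) × (∀ i → ZeroOrUnitModulo J (xs i))
      decide (yes x-unit) = J , I⊆J , λ { zero → inj₂ x-unit ; (suc i) → tail-ok i }
      decide (no 1∉adjoin) = K , J⊆K ∘ I⊆J , λ
        -- The witness `- 1#` puts `x` into `J + (x)`, because `x + x * - 1#` vanishes.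
        { zero    → inj₁ (- 1# , resp (sym x-x≈0) (Ideal.0∈I ideal))
        ; (suc i) → Sum.map J⊆K (λ (y , h) → y , J⊆K h) (tail-ok i) }
        where
        K : DecidableProperIdeal
        K = record { ideal = adjoin ideal x ; _∈I? = 1∈adjoin? ; proper = 1∉adjoin }
        J⊆K : (J ∈I) ⊆ (K ∈I)
        J⊆K {z} z∈J = 0# , resp (sym (trans (+-congˡ (zeroʳ x)) (+-identityʳ z))) z∈J
        x-x≈0 : x + x * - 1# ≈ 0#
        x-x≈0 = trans (+-congˡ (trans (sym (-‿distribʳ-* x 1#)) (-‿cong (*-identityʳ x)))) (-‿inverseʳ x)

    -- Greedily adding the elements of the finite ring one by one, unless this
    -- makes the ideal improper, yields a maximal ideal.
    maximalIdeal : (I : DecidableProperIdeal) → Σ[ J ∈ DecidableProperIdeal ]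
      (I ∈I) ⊆ (J ∈I) × (∀ x → ZeroOrUnitModulo J x)
    maximalIdeal I with enlarge enum I
    ... | J , I⊆J , enum-ok = J , I⊆J , λ x → let (i , eᵢ≈x) = enum-surjective x in
      Sum.map (resp eᵢ≈x) (λ (y , h) → y , resp (+-congˡ (*-congʳ eᵢ≈x)) h) (enum-ok i)
      where open DecidableProperIdeal J using (resp)

  residueField : (J : DecidableProperIdeal) → (∀ x → ZeroOrUnitModulo J x) → Field a a
  residueField J zeroOrUnit = record
    { commutativeRing = quotient
    ; 0≉1 = λ 0~1 → proper (~0⇒∈I (~-sym 0~1))
    ; invertible = inverse
    }
    where
    open DecidableProperIdeal J hiding (_∈I)
    inverse : ∀ x → ¬ (x ~ 0#) → ∃ λ y → (y * x ~ 1#) × (x * y ~ 1#)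
    inverse x x≁0 with zeroOrUnit x
    ... | inj₁ x∈J = contradiction (∈I⇒~0 x∈J) x≁0
    ... | inj₂ (y , 1+xy∈J) = - y , ~-trans (≈⇒~ (*-comm (- y) x)) x[-y]~1 , x[-y]~1
      where
      xy≈-x[-y] : x * y ≈ - (x * - y)
      xy≈-x[-y] = trans (*-congˡ (sym (⁻¹-involutive y))) (sym (-‿distribʳ-* x (- y)))
      x[-y]~1 : x * - y ~ 1#
      x[-y]~1 = ~-sym (resp (+-congˡ xy≈-x[-y]) 1+xy∈J)

-- Counting the elements of a field through the conjugates of `X`.

funToFin-cong : ∀ {m n} {f g : Fin m → Fin n} → f ≗ g → funToFin f ≡ funToFin g
funToFin-cong {zero}  f≗g = ≡.refl
funToFin-cong {suc m} f≗g = cong₂ combine (f≗g zero) (funToFin-cong (f≗g ∘ suc))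

finToFun-injective : ∀ {m n} {u v : Fin (m ℕ.^ n)} → finToFun {m} {n} u ≗ finToFun v → u ≡ v
finToFun-injective {m} {n} {u} {v} eq = begin
  u                              ≡⟨ Fin.funToFin-finToFin {n} {m} u ⟨
  funToFin (finToFun {m} {n} u)  ≡⟨ funToFin-cong eq ⟩
  funToFin (finToFun {m} {n} v)  ≡⟨ Fin.funToFin-finToFin {n} {m} v ⟩
  v                              ∎
  where open ≡.≡-Reasoning

module FiniteField {c ℓ : Level} (F : Field c ℓ) where

  open Field F hiding (zero)
  open Exp semiring using (_^_)
  open Mult semiring using (×-homo-+; ×-congˡ; ×1-homo-*) renaming (_×_ to _×′_)
  open CharacteristicP commutativeRing using (module Frobenius)
  open Polynomial commutativeRing
  open import Algebra.Properties.AbelianGroup +-abelianGroup using (identityʳ-unique)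
  open import Relation.Binary.Reasoning.Setoid setoid

  *-cancelˡ : ∀ x {y z} → ¬ (x ≈ 0#) → x * y ≈ x * z → y ≈ z
  *-cancelˡ x {y} {z} x≉0 xy≈xz = let (x⁻¹ , x⁻¹x≈1 , _) = invertible x x≉0 in begin
    y              ≈⟨ *-identityˡ y ⟨
    1# * y         ≈⟨ *-congʳ x⁻¹x≈1 ⟨
    (x⁻¹ * x) * y  ≈⟨ *-assoc x⁻¹ x y ⟩
    x⁻¹ * (x * y)  ≈⟨ *-congˡ xy≈xz ⟩
    x⁻¹ * (x * z)  ≈⟨ *-assoc x⁻¹ x z ⟨
    (x⁻¹ * x) * z  ≈⟨ *-congʳ x⁻¹x≈1 ⟩
    1# * z         ≈⟨ *-identityˡ z ⟩
    z              ∎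

  module _ {b} (f : ℕ → Carrier)
    (f[i]≉f[i+1+k] : ∀ i k → i ℕ.+ suc k < b → ¬ (f i ≈ f (i ℕ.+ suc k))) where

    <⇒f≉f : ∀ {i j} → i < j → j < b → ¬ (f i ≈ f j)
    <⇒f≉f {i} i<j j<b with ℕ.m≤n⇒∃[o]m+o≡n i<j
    ... | k , ≡.refl rewrite ≡.sym (ℕ.+-suc i k) = f[i]≉f[i+1+k] i k j<b

    -- Applied to the multiples of `1#` and to the conjugates of `X`. In both cases a coincidence at
    -- `i` and `i + suc k` can be shifted back to one at `0` and `suc k`.
    f∘toℕ-injective : ∀ {i j : Fin b} → f (toℕ i) ≈ f (toℕ j) → i ≡ j
    f∘toℕ-injective {i} {j} fi≈fj with ℕ.<-cmp (toℕ i) (toℕ j)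
    ... | tri< i<j _ _ = contradiction fi≈fj (<⇒f≉f i<j (Fin.toℕ<n j))
    ... | tri≈ _ i≡j _ = Fin.toℕ-injective i≡j
    ... | tri> _ _ j<i = contradiction (sym fi≈fj) (<⇒f≉f j<i (Fin.toℕ<n i))

  module Generator
    (_≟_ : ∀ x y → Dec (x ≈ y))
    {p n : ℕ} (pp : Prime p) (n≥1 : 1 ≤ n) (p×1≈0 : p ×′ 1# ≈ 0#)
    (x^pⁿ≈x : ∀ x → x ^ (p ℕ.^ n) ≈ x)
    (X : Carrier) (X^pᵐ≉X : ∀ {m} → 0 < m → m < n → ¬ (X ^ (p ℕ.^ m) ≈ X))
    where

    open Frobenius pp p×1≈0

    -- As `k` is coprime to `p`, a Bézout identity would turn the vanishing of both multiples of
    -- `1#` into `1# ≈ 0#`. Over the natural numbers the identity has two forms, depending on which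
    -- side is larger.
    k×1≉0 : ∀ {k} → 0 < k → k < p → ¬ (k ×′ 1# ≈ 0#)
    k×1≉0 {k} 0<k k<p k×1≈0 = 0≉1 (sym (1≈0 bézout))
      where
      bézout = coprime-Bézout (prime⇒coprime pp {{ℕ.>-nonZero 0<k}} k<p)
      multiple : ∀ y m → m ×′ 1# ≈ 0# → (y ℕ.* m) ×′ 1# ≈ 0#
      multiple y m m×1≈0 = trans (×1-homo-* y m) (trans (*-congˡ m×1≈0) (zeroʳ _))
      1+0≈0 : ∀ {x y} → x ×′ 1# ≈ 0# → y ×′ 1# ≈ 0# → 1 ℕ.+ x ≡ y → 1# ≈ 0#
      1+0≈0 {x} {y} x×1≈0 y×1≈0 eq = begin
        1#               ≈⟨ +-identityʳ 1# ⟨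
        1# + 0#          ≈⟨ +-congˡ x×1≈0 ⟨
        (1 ℕ.+ x) ×′ 1#  ≈⟨ ×-congˡ eq ⟩
        y ×′ 1#          ≈⟨ y×1≈0 ⟩
        0#               ∎
      1≈0 : Bézout.Identity 1 p k → 1# ≈ 0#
      1≈0 (Bézout.+- x y eq) = 1+0≈0 (multiple y k k×1≈0) (multiple x p p×1≈0) eq
      1≈0 (Bézout.-+ x y eq) = 1+0≈0 (multiple x p p×1≈0) (multiple y k k×1≈0) eq

    ×1-injective : ∀ {i j : Fin p} → toℕ i ×′ 1# ≈ toℕ j ×′ 1# → i ≡ j
    ×1-injective = f∘toℕ-injective (_×′ 1#) λ i k i+1+k<p i×1≈[i+1+k]×1 →
      k×1≉0 z<s (ℕ.≤-<-trans (ℕ.m≤n+m (suc k) i) i+1+k<p)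
        (identityʳ-unique (i ×′ 1#) _
          (trans (sym (×-homo-+ 1# i (suc k))) (sym i×1≈[i+1+k]×1)))

    -- The `n`-th iterate of Frobenius is the identity. Applying `l = n - i` further iterates to a
    -- coincidence at `i` and `i + suc k` therefore gives `X ≈ X ^p^ suc k`, which is excluded.
    X^pⁱ-injective : ∀ {i j : Fin n} → X ^p^ toℕ i ≈ X ^p^ toℕ j → i ≡ j
    X^pⁱ-injective = f∘toℕ-injective (X ^p^_) λ i k i+1+k<n X^pⁱ≈X^pⁱ⁺¹⁺ᵏ →
      let (l , i+l≡n) = ℕ.m≤n⇒∃[o]m+o≡n (ℕ.≤-trans (ℕ.m≤m+n i (suc k)) (ℕ.<⇒≤ i+1+k<n)) in
      X^pᵐ≉X {suc k} z<s (ℕ.≤-<-trans (ℕ.m≤n+m (suc k) i) i+1+k<n) (begin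
        X ^p^ suc k                  ≈⟨ ^p^-cong (suc k) (x^pⁿ≈x X) ⟨
        (X ^p^ n) ^p^ suc k          ≈⟨ ^p^-^p^ X n (suc k) ⟩
        X ^p^ (n ℕ.+ suc k)          ≡⟨ cong (X ^p^_) (≡.trans (cong (ℕ._+ suc k) (≡.sym i+l≡n))
                                                (xy∙z≈xz∙y i l (suc k))) ⟩
        X ^p^ (i ℕ.+ suc k ℕ.+ l)    ≈⟨ ^p^-^p^ X (i ℕ.+ suc k) l ⟨
        (X ^p^ (i ℕ.+ suc k)) ^p^ l  ≈⟨ ^p^-cong l X^pⁱ≈X^pⁱ⁺¹⁺ᵏ ⟨
        (X ^p^ i) ^p^ l              ≈⟨ ^p^-^p^ X i l ⟩
        X ^p^ (i ℕ.+ l)              ≡⟨ cong (X ^p^_) i+l≡n ⟩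
        X ^p^ n                      ≈⟨ x^pⁿ≈x X ⟩
        X                            ∎)

    -- Iterated Frobenius respects sums and products and fixes the coefficients, so it acts only on
    -- the argument.
    eval-^p^ : ∀ {d} (f : Fin d → Carrier) m → (∀ i → f i ^p^ m ≈ f i) →
      ∀ x → eval f x ^p^ m ≈ eval f (x ^p^ m)
    eval-^p^ {zero}  f m fixed x = 0^p^ m
    eval-^p^ {suc d} f m fixed x = begin
      (f zero + x * eval (f ∘ suc) x) ^p^ m        ≈⟨ ^p^-homo-+ m _ _ ⟩
      f zero ^p^ m + (x * eval (f ∘ suc) x) ^p^ m  ≈⟨ +-cong (fixed zero) (^p^-homo-* m _ _) ⟩
      f zero + x ^p^ m * eval (f ∘ suc) x ^p^ m    ≈⟨ +-congˡ (*-congˡ (eval-^p^ (f ∘ suc) m (fixed ∘ suc) x)) ⟩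
      f zero + x ^p^ m * eval (f ∘ suc) (x ^p^ m)  ∎

    -- The `n` base `p` digits of `u`, read in the prime field.
    coefficients : Fin (p ℕ.^ n) → Fin n → Carrier
    coefficients u i = toℕ (finToFun {p} {n} u i) ×′ 1#

    element : Fin (p ℕ.^ n) → Carrier
    element u = eval (coefficients u) X

    -- Frobenius carries an equality of values at `X` to all conjugates of `X`. These are `n`
    -- distinct nodes, as many as there are coefficients.
    element-injective : ∀ {u v} → element u ≈ element v → u ≡ v
    element-injective {u} {v} eq = finToFun-injective {p} {n} λ i → ×1-injective
      (interpolation-unique *-cancelˡ (coefficients u) (coefficients v) (λ i → X ^p^ toℕ i)
        X^pⁱ-injective agree i)
      where
      conjugate : ∀ u i → element u ^p^ i ≈ eval (coefficients u) (X ^p^ i)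
      conjugate u i = eval-^p^ (coefficients u) i (λ j → [n×1]^p^≈n×1 i (toℕ (finToFun {p} {n} u j))) X
      agree : ∀ (i : Fin n) → eval (coefficients u) (X ^p^ toℕ i) ≈ eval (coefficients v) (X ^p^ toℕ i)
      agree i = trans (sym (conjugate u (toℕ i))) (trans (^p^-cong (toℕ i) eq) (conjugate v (toℕ i)))

    -- A missing `x` would give, with the `q` known elements, `q + 1` distinct nodes at which `T^q`
    -- and `T` agree. Both have `q + 1` coefficients, so they would coincide.
    element-surjective : ∀ x → ∃ λ u → element u ≈ x
    element-surjective x with Fin.any? (λ u → element u ≟ x)
    ... | yes found = found
    ... | no ¬found = contradiction (sym 1≈0) 0≉1
      where
      q = p ℕ.^ n
      1<q : 1 < q
      1<q = ℕ.^-monoʳ-< p (ℕ.nonTrivial⇒n>1 p {{prime⇒nonTrivial pp}}) n≥1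
      i₁ = Fin.fromℕ< (ℕ.m<n⇒m<1+n 1<q)
      iq = Fin.fromℕ q
      roots : Fin (suc q) → Carrier
      roots zero    = x
      roots (suc u) = element u
      roots-injective : ∀ {i j} → roots i ≈ roots j → i ≡ j
      roots-injective {zero}  {zero}  _  = ≡.refl
      roots-injective {zero}  {suc j} eq = contradiction (j , sym eq) ¬found
      roots-injective {suc i} {zero}  eq = contradiction (i , eq) ¬found
      roots-injective {suc i} {suc j} eq = cong suc (element-injective eq)
      agree : ∀ i → eval (monomial iq) (roots i) ≈ eval (monomial i₁) (roots i)
      agree i = let r = roots i in begin
        eval (monomial iq) r  ≈⟨ eval-monomial iq r ⟩
        r ^ toℕ iq            ≡⟨ cong (r ^_) (Fin.toℕ-fromℕ q) ⟩
        r ^ q                 ≈⟨ x^pⁿ≈x r ⟩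
        r                     ≈⟨ *-identityʳ r ⟨
        r ^ 1                 ≡⟨ cong (r ^_) (Fin.toℕ-fromℕ< (ℕ.m<n⇒m<1+n 1<q)) ⟨
        r ^ toℕ i₁            ≈⟨ eval-monomial i₁ r ⟨
        eval (monomial i₁) r  ∎
      i₁≢iq : i₁ ≢ iq
      i₁≢iq eq = ℕ.<⇒≢ 1<q (≡.trans (≡.sym (Fin.toℕ-fromℕ< (ℕ.m<n⇒m<1+n 1<q)))
                              (≡.trans (cong toℕ eq) (Fin.toℕ-fromℕ q)))
      1≈0 : 1# ≈ 0#
      1≈0 = begin
        1#              ≡⟨ monomial-diagonal iq ⟨
        -- The coefficients of `T^q` are compared at exponent `q`, which differs from `1` because
        -- `1 < q`.
        monomial iq iq  ≈⟨ interpolation-unique *-cancelˡ (monomial iq) (monomial i₁) roots roots-injective agree iq ⟩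
        monomial i₁ iq  ≡⟨ monomial-off-diagonal i₁ iq i₁≢iq ⟩
        0#              ∎

    hasCardinality : HasCardinality setoid (p ℕ.^ n)
    hasCardinality = record
      { to = index
      ; from = element
      ; to-cong = λ {x} {y} x≈y → element-injective (trans (element-index x) (trans x≈y (sym (element-index y))))
      ; from-cong = λ { ≡.refl → refl }
      ; inverse = (λ {u} {x} x≈eᵤ → element-injective (trans (element-index x) x≈eᵤ))
                , (λ { {x} ≡.refl → element-index x })
      }
      where
      index : Carrier → Fin (p ℕ.^ n)
      index x = proj₁ (element-surjective x)
      element-index : ∀ x → element (index x) ≈ x
      element-index x = proj₂ (element-surjective x)

-- Lists of exponents and the group ring of ℤ/N over ℤ/p.

+-%-cong : ∀ n .{{_ : NonZero n}} {a a′ b b′} → a % n ≡ a′ % n → b % n ≡ b′ % n →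
  (a ℕ.+ b) % n ≡ (a′ ℕ.+ b′) % n
+-%-cong n {a} {a′} {b} {b′} a≡a′ b≡b′ = begin
  (a ℕ.+ b) % n            ≡⟨ %-distribˡ-+ a b n ⟩
  (a % n ℕ.+ b % n) % n    ≡⟨ cong₂ (λ x y → (x ℕ.+ y) % n) a≡a′ b≡b′ ⟩
  (a′ % n ℕ.+ b′ % n) % n  ≡⟨ %-distribˡ-+ a′ b′ n ⟨
  (a′ ℕ.+ b′) % n          ∎
  where open ≡.≡-Reasoning

infixl 7 _⊛_
-- Exponents are left unreduced, so that associativity and right distributivity are equalities of
-- lists. Commutativity holds only up to reordering.
_⊛_ : List ℕ → List ℕ → List ℕ
[]      ⊛ g = []
(i ∷ f) ⊛ g = map (i ℕ.+_) g ++ f ⊛ g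

⊛-distribʳ-++ : ∀ f g h → (f ++ g) ⊛ h ≡ f ⊛ h ++ g ⊛ h
⊛-distribʳ-++ []      g h = ≡.refl
⊛-distribʳ-++ (i ∷ f) g h = ≡.trans (cong (map (i ℕ.+_) h ++_) (⊛-distribʳ-++ f g h))
                               (≡.sym (++-assoc (map (i ℕ.+_) h) (f ⊛ h) (g ⊛ h)))

map-+-⊛ : ∀ i g h → map (i ℕ.+_) g ⊛ h ≡ map (i ℕ.+_) (g ⊛ h)
map-+-⊛ i []      h = ≡.refl
map-+-⊛ i (j ∷ g) h = begin
  map (i ℕ.+ j ℕ.+_) h ++ map (i ℕ.+_) g ⊛ h
    ≡⟨ cong₂ _++_ (≡.trans (List.map-cong (ℕ.+-assoc i j) h) (List.map-∘ h)) (map-+-⊛ i g h) ⟩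
  map (i ℕ.+_) (map (j ℕ.+_) h) ++ map (i ℕ.+_) (g ⊛ h)
    ≡⟨ map-++ (i ℕ.+_) (map (j ℕ.+_) h) (g ⊛ h) ⟨
  map (i ℕ.+_) (map (j ℕ.+_) h ++ g ⊛ h)  ∎
  where open ≡.≡-Reasoning

⊛-assoc : ∀ f g h → (f ⊛ g) ⊛ h ≡ f ⊛ (g ⊛ h)
⊛-assoc []      g h = ≡.refl
⊛-assoc (i ∷ f) g h = ≡.trans (⊛-distribʳ-++ (map (i ℕ.+_) g) (f ⊛ g) h)
                         (cong₂ _++_ (map-+-⊛ i g h) (⊛-assoc f g h))

-- The group ring of ℤ/N over ℤ/p. A list of exponents stands for the sum of
-- the corresponding monomials, so that negation is multiplication by p - 1.
module GroupRing (p N : ℕ) .{{_ : NonZero p}} .{{_ : NonZero N}} where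

  isZero : ℕ → ℕ
  isZero zero    = 1
  isZero (suc _) = 0

  -- The indicator of divisibility by `N`. Testing `k + i` detects the exponents congruent to `- k`
  -- without subtraction.
  δ : ℕ → ℕ
  δ k = isZero (k % N)

  δ-cong : ∀ {k l} → k % N ≡ l % N → δ k ≡ δ l
  δ-cong = cong isZero

  -- The coefficient of the monomial with exponent - k.
  count : ℕ → List ℕ → ℕ
  count k []      = 0
  count k (i ∷ f) = δ (k ℕ.+ i) ℕ.+ count k f

  infix 4 _≈_
  -- Equality of all coefficients modulo `p`. Being a record, the relation does not unfold, and `f`
  -- and `g` can be inferred from its type.
  record _≈_ (f g : List ℕ) : Set where
    constructor mk≈
    field count-≈ : ∀ k → count k f % p ≡ count k g % p
  open _≈_

  ≗⇒≈ : ∀ {f g} → (∀ k → count k f ≡ count k g) → f ≈ g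
  ≗⇒≈ eq = mk≈ λ k → cong (_% p) (eq k)

  ≡⇒≈ : ∀ {f g} → f ≡ g → f ≈ g
  ≡⇒≈ ≡.refl = mk≈ λ k → ≡.refl

  ≈-sym : ∀ {f g} → f ≈ g → g ≈ f
  ≈-sym (mk≈ f≈g) = mk≈ λ k → ≡.sym (f≈g k)

  ≈-trans : ∀ {f g h} → f ≈ g → g ≈ h → f ≈ h
  ≈-trans (mk≈ f≈g) (mk≈ g≈h) = mk≈ λ k → ≡.trans (f≈g k) (g≈h k)

  count-cong : ∀ {k l} → k % N ≡ l % N → ∀ f → count k f ≡ count l f
  count-cong eq []      = ≡.refl
  count-cong eq (i ∷ f) = cong₂ ℕ._+_ (δ-cong (+-%-cong N eq ≡.refl)) (count-cong eq f)

  -- Coefficients depend on `k` only modulo `N`, so finitely many comparisons suffice.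
  _≈?_ : ∀ f g → Dec (f ≈ g)
  f ≈? g = map′ (λ eq → mk≈ (periodic eq)) (λ f≈g i → count-≈ f≈g (toℕ i))
    (Fin.all? λ (i : Fin N) → count (toℕ i) f % p ℕ.≟ count (toℕ i) g % p)
    where
    periodic : (∀ (i : Fin N) → count (toℕ i) f % p ≡ count (toℕ i) g % p) →
      ∀ k → count k f % p ≡ count k g % p
    periodic eq k = begin
      count k f % p        ≡⟨ cong (_% p) (count-cong k≡i f) ⟩
      count (toℕ i) f % p  ≡⟨ eq i ⟩
      count (toℕ i) g % p  ≡⟨ cong (_% p) (count-cong k≡i g) ⟨
      count k g % p        ∎
      where
      open ≡.≡-Reasoning
      i = Fin.fromℕ< (m%n<n k N)
      k≡i : k % N ≡ toℕ i % N
      k≡i = ≡.sym (≡.trans (cong (_% N) (Fin.toℕ-fromℕ< (m%n<n k N))) (m%n%n≡m%n k N))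

  count-++ : ∀ k f g → count k (f ++ g) ≡ count k f ℕ.+ count k g
  count-++ k []      g = ≡.refl
  count-++ k (i ∷ f) g = ≡.trans (cong (δ (k ℕ.+ i) ℕ.+_) (count-++ k f g))
                           (≡.sym (ℕ.+-assoc (δ (k ℕ.+ i)) (count k f) (count k g)))

  count-map-+ : ∀ k i g → count k (map (i ℕ.+_) g) ≡ count (k ℕ.+ i) g
  count-map-+ k i []      = ≡.refl
  count-map-+ k i (j ∷ g) = cong₂ ℕ._+_ (cong δ (≡.sym (ℕ.+-assoc k i j))) (count-map-+ k i g)

  count-⊛-∷ˡ : ∀ k i f g → count k ((i ∷ f) ⊛ g) ≡ count (k ℕ.+ i) g ℕ.+ count k (f ⊛ g)
  count-⊛-∷ˡ k i f g = ≡.trans (count-++ k (map (i ℕ.+_) g) (f ⊛ g))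
                          (cong (ℕ._+ count k (f ⊛ g)) (count-map-+ k i g))

  count-⊛-[]ʳ : ∀ k g → count k (g ⊛ []) ≡ 0
  count-⊛-[]ʳ k []      = ≡.refl
  count-⊛-[]ʳ k (j ∷ g) = count-⊛-[]ʳ k g

  -- The mirror image of `count-⊛-∷ˡ`; together they give commutativity by induction on one factor.
  count-⊛-∷ʳ : ∀ k g i f → count k (g ⊛ (i ∷ f)) ≡ count (k ℕ.+ i) g ℕ.+ count k (g ⊛ f)
  count-⊛-∷ʳ k []      i f = ≡.refl
  count-⊛-∷ʳ k (j ∷ g) i f = begin
    count k ((j ∷ g) ⊛ (i ∷ f))
      ≡⟨ count-⊛-∷ˡ k j g (i ∷ f) ⟩
    (δ (k ℕ.+ j ℕ.+ i) ℕ.+ count (k ℕ.+ j) f) ℕ.+ count k (g ⊛ (i ∷ f))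
      ≡⟨ cong₂ (λ x y → δ x ℕ.+ count (k ℕ.+ j) f ℕ.+ y) (xy∙z≈xz∙y k j i) (count-⊛-∷ʳ k g i f) ⟩
    (δ (k ℕ.+ i ℕ.+ j) ℕ.+ count (k ℕ.+ j) f) ℕ.+ (count (k ℕ.+ i) g ℕ.+ count k (g ⊛ f))
      ≡⟨ interchange (δ (k ℕ.+ i ℕ.+ j)) _ _ _ ⟩
    (δ (k ℕ.+ i ℕ.+ j) ℕ.+ count (k ℕ.+ i) g) ℕ.+ (count (k ℕ.+ j) f ℕ.+ count k (g ⊛ f))
      ≡⟨ cong (count (k ℕ.+ i) (j ∷ g) ℕ.+_) (count-⊛-∷ˡ k j g f) ⟨
    count (k ℕ.+ i) (j ∷ g) ℕ.+ count k ((j ∷ g) ⊛ f)  ∎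
    where open ≡.≡-Reasoning

  count-⊛-comm : ∀ k f g → count k (f ⊛ g) ≡ count k (g ⊛ f)
  count-⊛-comm k []      g = ≡.sym (count-⊛-[]ʳ k g)
  count-⊛-comm k (i ∷ f) g = begin
    count k ((i ∷ f) ⊛ g)                  ≡⟨ count-⊛-∷ˡ k i f g ⟩
    count (k ℕ.+ i) g ℕ.+ count k (f ⊛ g)  ≡⟨ cong (count (k ℕ.+ i) g ℕ.+_) (count-⊛-comm k f g) ⟩
    count (k ℕ.+ i) g ℕ.+ count k (g ⊛ f)  ≡⟨ count-⊛-∷ʳ k g i f ⟨
    count k (g ⊛ (i ∷ f))                  ∎
    where open ≡.≡-Reasoning

  ⊛-comm : ∀ f g → f ⊛ g ≈ g ⊛ f
  ⊛-comm f g = ≗⇒≈ λ k → count-⊛-comm k f g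

  ++-cong : ∀ {f f′ g g′} → f ≈ f′ → g ≈ g′ → f ++ g ≈ f′ ++ g′
  ++-cong {f} {f′} {g} {g′} f≈f′ g≈g′ = mk≈ λ k → begin
    count k (f ++ g) % p             ≡⟨ cong (_% p) (count-++ k f g) ⟩
    (count k f ℕ.+ count k g) % p    ≡⟨ +-%-cong p (count-≈ f≈f′ k) (count-≈ g≈g′ k) ⟩
    (count k f′ ℕ.+ count k g′) % p  ≡⟨ cong (_% p) (count-++ k f′ g′) ⟨
    count k (f′ ++ g′) % p           ∎
    where open ≡.≡-Reasoning

  ++-comm : ∀ f g → f ++ g ≈ g ++ f
  ++-comm f g = ≗⇒≈ λ k → ≡.trans (count-++ k f g)
    (≡.trans (ℕ.+-comm (count k f) (count k g)) (≡.sym (count-++ k g f)))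

  ⊛-congˡ : ∀ f {g g′} → g ≈ g′ → f ⊛ g ≈ f ⊛ g′
  ⊛-congˡ []      g≈g′ = ≡⇒≈ ≡.refl
  ⊛-congˡ (i ∷ f) {g} {g′} g≈g′ = ++-cong shifted (⊛-congˡ f g≈g′)
    where
    shifted : map (i ℕ.+_) g ≈ map (i ℕ.+_) g′
    shifted = mk≈ λ k → ≡.trans (cong (_% p) (count-map-+ k i g))
      (≡.trans (count-≈ g≈g′ (k ℕ.+ i)) (cong (_% p) (≡.sym (count-map-+ k i g′))))

  ⊛-cong : ∀ {f f′ g g′} → f ≈ f′ → g ≈ g′ → f ⊛ g ≈ f′ ⊛ g′
  ⊛-cong {f} {f′} {g} {g′} f≈f′ g≈g′ = ≈-trans (⊛-congˡ f g≈g′)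
    (≈-trans (⊛-comm f g′) (≈-trans (⊛-congˡ g′ f≈f′) (⊛-comm g′ f′)))

  ⊛-identityˡ : ∀ f → [ 0 ] ⊛ f ≡ f
  ⊛-identityˡ f = ≡.trans (++-identityʳ (map (0 ℕ.+_) f)) (List.map-id f)

  ⊛-distribˡ-++ : ∀ f g h → f ⊛ (g ++ h) ≈ f ⊛ g ++ f ⊛ h
  ⊛-distribˡ-++ f g h = ≈-trans (⊛-comm f (g ++ h))
    (≈-trans (≡⇒≈ (⊛-distribʳ-++ g h f)) (++-cong (⊛-comm g f) (⊛-comm h f)))

  count-copies : ∀ k n f → count k (n copies f) ≡ n ℕ.* count k f
  count-copies k zero    f = ≡.refl
  count-copies k (suc n) f = ≡.trans (count-++ k f (n copies f)) (cong (count k f ℕ.+_) (count-copies k n f))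

  copies-cong : ∀ n {f g} → f ≈ g → n copies f ≈ n copies g
  copies-cong zero    f≈g = ≡⇒≈ ≡.refl
  copies-cong (suc n) f≈g = ++-cong f≈g (copies-cong n f≈g)

  p-copies : ∀ f → p copies f ≈ []
  p-copies f = mk≈ λ k → begin
    count k (p copies f) % p  ≡⟨ cong (_% p) (≡.trans (count-copies k p f) (ℕ.*-comm p (count k f))) ⟩
    (count k f ℕ.* p) % p     ≡⟨ m*n%n≡0 (count k f) p ⟩
    0                         ≡⟨ m*n%n≡0 0 p ⟨
    0 % p                     ∎
    where open ≡.≡-Reasoning

  ++-inverseʳ : ∀ f → f ++ pred p copies f ≈ []
  ++-inverseʳ f = ≡.subst (λ m → m copies f ≈ []) (≡.sym (ℕ.suc-pred p)) (p-copies f)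

  groupRing : CommutativeRing _ _
  groupRing = record
    { Carrier = List ℕ ; _≈_ = _≈_ ; _+_ = _++_ ; _*_ = _⊛_ ; -_ = pred p copies_ ; 0# = [] ; 1# = [ 0 ]
    ; isCommutativeRing = record
      { isRing = record
        { +-isAbelianGroup = record
          { isGroup = record
            { isMonoid = record
              { isSemigroup = record
                { isMagma = record
                  { isEquivalence = record { refl = ≡⇒≈ ≡.refl ; sym = ≈-sym ; trans = ≈-trans }
                  ; ∙-cong = ++-cong
                  }
                ; assoc = λ f g h → ≡⇒≈ (++-assoc f g h)
                }
              ; identity = (λ f → ≡⇒≈ ≡.refl) , (λ f → ≡⇒≈ (++-identityʳ f))
              }
            ; inverse = (λ f → ≈-trans (++-comm (pred p copies f) f) (++-inverseʳ f)) , ++-inverseʳ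
            ; ⁻¹-cong = copies-cong (pred p)
            }
          ; comm = ++-comm
          }
        ; *-cong = ⊛-cong
        ; *-assoc = λ f g h → ≡⇒≈ (⊛-assoc f g h)
        ; *-identity = (λ f → ≡⇒≈ (⊛-identityˡ f))
                     , (λ f → ≈-trans (⊛-comm f [ 0 ]) (≡⇒≈ (⊛-identityˡ f)))
        ; distrib = ⊛-distribˡ-++ , (λ f g h → ≡⇒≈ (⊛-distribʳ-++ g h f))
        }
      ; *-comm = ⊛-comm
      }
    }

  open CommutativeRing groupRing using (semiring; setoid; +-congˡ; +-congʳ; +-commutativeSemigroup)
  open Exp semiring using (_^_)
  open Mult semiring using () renaming (_×_ to _×′_)

  -- Negation needs multiples before the ring exists; this identifies them with the multiples that
  -- the ring provides.
  copies≡× : ∀ n f → n copies f ≡ n ×′ f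
  copies≡× zero    f = ≡.refl
  copies≡× (suc n) f = cong (f ++_) (copies≡× n f)

  p×1≈0 : p ×′ [ 0 ] ≈ []
  p×1≈0 = ≈-trans (≡⇒≈ (≡.sym (copies≡× p [ 0 ]))) (p-copies [ 0 ])

  -- The base `p` digits of `u` are the multiplicities of the exponents below `d`, so for `d = N`
  -- these are normal forms.
  enumerate : ∀ d → Fin (p ℕ.^ d) → List ℕ
  enumerate zero    u = []
  enumerate (suc d) u = let (j , v) = remQuot {p} (p ℕ.^ d) u in toℕ j copies [ d ] ++ enumerate d v

  enumerate-combine : ∀ d j v → enumerate (suc d) (combine j v) ≡ toℕ j copies [ d ] ++ enumerate d v
  enumerate-combine d j v =
    cong (λ (j , v) → toℕ j copies [ d ] ++ enumerate d v) (Fin.remQuot-combine {p} j v)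

  private
    0F : Fin p
    0F = Fin.fromℕ< (ℕ.>-nonZero⁻¹ p)

    toℕ-0F : toℕ 0F ≡ 0
    toℕ-0F = Fin.toℕ-fromℕ< (ℕ.>-nonZero⁻¹ p)

  enumerate-[] : ∀ d → ∃ λ u → enumerate d u ≡ []
  enumerate-[] zero    = zero , ≡.refl
  enumerate-[] (suc d) = let (v , eq) = enumerate-[] d in
    combine 0F v , ≡.trans (enumerate-combine d 0F v) (cong₂ (λ j g → j copies [ d ] ++ g) toℕ-0F eq)

  open import Relation.Binary.Reasoning.Setoid setoid
  open import Algebra.Properties.CommutativeSemigroup +-commutativeSemigroup
    using (x∙yz≈y∙xz)

  -- Adding a monomial increments one digit modulo `p`, without a carry.
  enumerate-∷ : ∀ d {i} → i < d → ∀ u → ∃ λ v → enumerate d v ≈ i ∷ enumerate d u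
  enumerate-∷ (suc d) {i} i<1+d u with ℕ.m<1+n⇒m<n∨m≡n i<1+d
  ... | inj₁ i<d = let (j , v) = remQuot {p} (p ℕ.^ d) u ; (v′ , eq) = enumerate-∷ d i<d v in
    combine j v′ , (begin
      enumerate (suc d) (combine j v′)                ≡⟨ enumerate-combine d j v′ ⟩
      toℕ j copies [ d ] ++ enumerate d v′            ≈⟨ +-congˡ {toℕ j copies [ d ]} eq ⟩
      toℕ j copies [ d ] ++ ([ i ] ++ enumerate d v)  ≈⟨ x∙yz≈y∙xz (toℕ j copies [ d ]) [ i ] (enumerate d v) ⟩
      i ∷ (toℕ j copies [ d ] ++ enumerate d v)       ∎)
  ... | inj₂ ≡.refl = increment (remQuot {p} (p ℕ.^ d) u)
    where
    increment : ((j , v) : Fin p × Fin (p ℕ.^ d)) →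
      ∃ λ v′ → enumerate (suc d) v′ ≈ d ∷ (toℕ j copies [ d ] ++ enumerate d v)
    increment (j , v) with ℕ.m≤n⇒m<n∨m≡n (Fin.toℕ<n j)
    ... | inj₁ 1+j<p = combine (Fin.fromℕ< 1+j<p) v ,
      ≡⇒≈ (≡.trans (enumerate-combine d (Fin.fromℕ< 1+j<p) v)
            (cong (λ m → m copies [ d ] ++ enumerate d v) (Fin.toℕ-fromℕ< 1+j<p)))
    -- The digit was `p - 1` and wraps to zero, since `p` copies of a monomial vanish.
    ... | inj₂ 1+j≡p = combine 0F v , (begin
      enumerate (suc d) (combine 0F v)           ≡⟨ enumerate-combine d 0F v ⟩
      toℕ 0F copies [ d ] ++ enumerate d v       ≡⟨ cong (λ m → m copies [ d ] ++ enumerate d v) toℕ-0F ⟩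
      enumerate d v                              ≈⟨ +-congʳ (p-copies [ d ]) ⟨
      p copies [ d ] ++ enumerate d v            ≡⟨ cong (λ m → m copies [ d ] ++ enumerate d v) 1+j≡p ⟨
      d ∷ (toℕ j copies [ d ] ++ enumerate d v)  ∎)

  [i]≈[j] : ∀ {i j} → i % N ≡ j % N → [ i ] ≈ [ j ]
  [i]≈[j] eq = ≗⇒≈ λ k → cong (ℕ._+ 0) (δ-cong (+-%-cong N {k} ≡.refl eq))

  enumerate-surjective : ∀ f → ∃ λ u → enumerate N u ≈ f
  enumerate-surjective []      = let (u , eq) = enumerate-[] N in u , ≡⇒≈ eq
  enumerate-surjective (i ∷ f) =
    let (u , eᵤ≈f) = enumerate-surjective f ; (v , eᵥ≈i∷eᵤ) = enumerate-∷ N (m%n<n i N) u in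
    v , ≈-trans eᵥ≈i∷eᵤ (++-cong ([i]≈[j] (m%n%n≡m%n i N)) eᵤ≈f)

  [i]^m≡[m*i] : ∀ i m → [ i ] ^ m ≡ [ m ℕ.* i ]
  [i]^m≡[m*i] i zero    = ≡.refl
  [i]^m≡[m*i] i (suc m) = cong ([ i ] ⊛_) ([i]^m≡[m*i] i m)

  -- Exponents are compared as natural numbers, before reduction modulo N.
  IsMonic : ℕ → List ℕ → Set
  IsMonic d f = ∃ λ g → f ≡ d ∷ g × All (_< d) g

  All-⊛-< : ∀ {d e f g} → All (_< d) f → All (_≤ e) g → All (_< d ℕ.+ e) (f ⊛ g)
  All-⊛-< []           g≤e = []
  All-⊛-< (i<d ∷ f<d)  g≤e = All.++⁺ (All.map⁺ (All.map (ℕ.+-mono-<-≤ i<d) g≤e)) (All-⊛-< f<d g≤e)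

  ⊛-monic : ∀ {d e f g} → IsMonic d f → IsMonic e g → IsMonic (d ℕ.+ e) (f ⊛ g)
  ⊛-monic {d} {e} (f , ≡.refl , f<d) (g , ≡.refl , g<e) =
    map (d ℕ.+_) g ++ f ⊛ (e ∷ g) , ≡.refl ,
    All.++⁺ (All.map⁺ (All.map (ℕ.+-monoʳ-< d) g<e)) (All-⊛-< f<d (ℕ.≤-refl ∷ All.map ℕ.<⇒≤ g<e))

  copies-< : ∀ {d i} n → i < d → All (_< d) (n copies [ i ])
  copies-< zero    i<d = []
  copies-< (suc n) i<d = i<d ∷ copies-< n i<d

  -- Below degree `N` no exponent wraps around, so the leading monomial alone contributes to its
  -- coefficient, which is `1` and hence nonzero modulo `p`.
  monic⇒≉[] : 1 < p → ∀ {d f} → d < N → IsMonic d f → ¬ (f ≈ [])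
  monic⇒≉[] 1<p {d} d<N (g , ≡.refl , g<d) f≈[] = contradiction 1≡0 λ ()
    where
    -- As `count` reads the exponent `- k`, this choice selects the exponent `d`.
    k = N ∸ d
    δ-0 : δ (k ℕ.+ d) ≡ 1
    δ-0 = cong isZero (≡.trans (cong (_% N) (ℕ.m∸n+n≡m (ℕ.<⇒≤ d<N))) (n%n≡0 N))
    δ-rest : ∀ {i} → i < d → δ (k ℕ.+ i) ≡ 0
    δ-rest {i} i<d rewrite m<n⇒m%n≡m (≡.subst (k ℕ.+ i <_) (ℕ.m∸n+n≡m (ℕ.<⇒≤ d<N)) (ℕ.+-monoʳ-< k i<d))
      -- The sum is already below `N`; it is positive because `d < N`, so the indicator is zero.
      with k ℕ.+ i | ℕ.<-≤-trans (ℕ.m<n⇒0<n∸m d<N) (ℕ.m≤m+n k i)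
    ... | suc _ | _ = ≡.refl
    count-rest : ∀ {g} → All (_< d) g → count k g ≡ 0
    count-rest []            = ≡.refl
    count-rest (i<d ∷ g<d)   = cong₂ ℕ._+_ (δ-rest i<d) (count-rest g<d)
    1≡0 : 1 ≡ 0
    1≡0 = ≡.trans (≡.sym (m<n⇒m%n≡m 1<p))
      (≡.trans (cong (_% p) (≡.sym (cong₂ ℕ._+_ δ-0 (count-rest g<d))))
        (≡.trans (count-≈ f≈[] k) (m*n%n≡0 0 p)))

-- The field with `q` elements as a residue field of the group ring.

module Construction (p m : ℕ) (pp : Prime p) where

  n q N : ℕ
  n = suc m
  q = p ℕ.^ n
  N = pred q

  1<p : 1 < p
  1<p = ℕ.nonTrivial⇒n>1 p {{prime⇒nonTrivial pp}}

  1<q : 1 < q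
  1<q = ℕ.^-monoʳ-< p 1<p {0} {n} z<s

  1+N≡q : suc N ≡ q
  1+N≡q = ℕ.suc-pred q {{ℕ.>-nonZero (ℕ.<-trans z<s 1<q)}}

  instance
    p≢0 : NonZero p
    p≢0 = prime⇒nonZero pp

    N≢0 : NonZero N
    N≢0 = ℕ.>-nonZero (ℕ.pred-mono-≤ 1<q)

  open GroupRing p N using
    ( groupRing; _≈?_; enumerate; enumerate-surjective; p×1≈0; ≡⇒≈; [i]≈[j]; [i]^m≡[m*i]
    ; IsMonic; ⊛-monic; copies-<; monic⇒≉[])
  open CommutativeRing groupRing hiding (zero)

  open Exp semiring using (_^_)
  open CharacteristicP.Frobenius groupRing pp p×1≈0
  open Ideals groupRing
  open DecidableProperIdeal using (_∈I)

  X : Carrier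
  X = [ 1 ]

  f^q≈f : ∀ f → f ^ q ≈ f
  f^q≈f []      = 0^p^ n
  f^q≈f (i ∷ f) = trans (^p^-homo-+ n [ i ] f) (+-cong [i]^q≈[i] (f^q≈f f))
    where
    -- Since `q = N + 1`, the exponent `q * i` is `i` plus a multiple of `N`.
    qi%N≡i%N : (q ℕ.* i) % N ≡ i % N
    qi%N≡i%N = ≡.trans
      (cong (_% N) (≡.trans (cong (ℕ._* i) (≡.sym 1+N≡q)) (cong (i ℕ.+_) (ℕ.*-comm N i))))
      ([m+kn]%n≡m%n i i N)
    [i]^q≈[i] : [ i ] ^ q ≈ [ i ]
    [i]^q≈[i] = trans (≡⇒≈ ([i]^m≡[m*i] i q)) ([i]≈[j] qi%N≡i%N)

  a : ℕ → Carrier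
  a zero    = 1#
  a (suc i) = (X ^p^ suc i - X) * a i

  deg-a : ℕ → ℕ
  deg-a zero    = 0
  deg-a (suc i) = p ℕ.^ suc i ℕ.+ deg-a i

  X^pⁱ-X-monic : ∀ i → IsMonic (p ℕ.^ suc i) (X ^p^ suc i - X)
  X^pⁱ-X-monic i = - X
    , cong (_++ - X) (≡.trans ([i]^m≡[m*i] 1 (p ℕ.^ suc i)) (cong [_] (ℕ.*-identityʳ (p ℕ.^ suc i))))
    , copies-< (pred p) (ℕ.^-monoʳ-< p 1<p {0} {suc i} z<s)

  a-monic : ∀ i → IsMonic (deg-a i) (a i)
  a-monic zero    = [] , ≡.refl , []
  a-monic (suc i) = ⊛-monic (X^pⁱ-X-monic i) (a-monic i)

  -- The summand `2` yields `deg-a m < N = q - 1` at `i = m`. The induction step only needs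
  -- `P + P ≤ p * P`.
  deg-a+2≤p^[1+i] : ∀ i → deg-a i ℕ.+ 2 ≤ p ℕ.^ suc i
  deg-a+2≤p^[1+i] zero    = ≡.subst (2 ≤_) (≡.sym (ℕ.*-identityʳ p)) 1<p
  deg-a+2≤p^[1+i] (suc i) = begin
    P ℕ.+ deg-a i ℕ.+ 2    ≡⟨ ℕ.+-assoc P (deg-a i) 2 ⟩
    P ℕ.+ (deg-a i ℕ.+ 2)  ≤⟨ ℕ.+-monoʳ-≤ P (deg-a+2≤p^[1+i] i) ⟩
    P ℕ.+ P                ≡⟨ cong (P ℕ.+_) (ℕ.+-identityʳ P) ⟨
    2 ℕ.* P                ≤⟨ ℕ.*-monoˡ-≤ P 1<p ⟩
    p ℕ.* P                ∎
    where
    open ℕ.≤-Reasoning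
    P = p ℕ.^ suc i

  a≉0 : ¬ (a m ≈ 0#)
  a≉0 = monic⇒≉[] 1<p deg-a<N (a-monic m)
    where
    deg-a<N : deg-a m < N
    deg-a<N = ℕ.≤-pred (≡.subst₂ _≤_ (ℕ.+-comm (deg-a m) 2) (≡.sym 1+N≡q) (deg-a+2≤p^[1+i] m))

  I : DecidableProperIdeal
  I = record
    { ideal  = annihilator (a m)
    ; _∈I?   = λ f → (a m * f) ≈? 0#
    ; proper = λ a*1≈0 → a≉0 (trans (sym (*-identityʳ (a m))) a*1≈0)
    }

  -- Multiplying by `a m` gives `a^q - a`, which vanishes. Thus `a m` is a unit modulo its
  -- annihilator.
  aᴺ-1∈I : (I ∈I) (a m ^ N - 1#)
  aᴺ-1∈I = begin
    a m * (a m ^ N - 1#)    ≈⟨ x[y-z]≈xy-xz (a m) (a m ^ N) 1# ⟩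
    a m ^ suc N - a m * 1#  ≡⟨ cong (λ k → a m ^ k - a m * 1#) 1+N≡q ⟩
    a m ^ q - a m * 1#      ≈⟨ +-cong (f^q≈f (a m)) (-‿cong {a m * 1#} (*-identityʳ (a m))) ⟩
    a m - a m               ≈⟨ -‿inverseʳ (a m) ⟩
    0#                      ∎
    where
    open import Relation.Binary.Reasoning.Setoid setoid
    open import Algebra.Properties.Ring ring using (x[y-z]≈xy-xz)

  maximal = maximalIdeal (enumerate N) enumerate-surjective I

  J : DecidableProperIdeal
  J = proj₁ maximal

  open DecidableProperIdeal J
    using (resp; *-closed; _~_; ~-sym; ~-trans; ∈I⇒~0; ~0⇒∈I; proper; _∈I?; ≈⇒~; quotient-^; quotient-×)

  -- Modulo `J` the `N`-th power of `a m` is `1#`, whereas `a m` in `J` would make it zero.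
  a∉J : ¬ (J ∈I) (a m)
  a∉J a∈J = proper (~0⇒∈I (~-trans (~-sym (proj₁ (proj₂ maximal) aᴺ-1∈I)) (∈I⇒~0 aᴺ∈J)))
    where
    aᴺ∈J : (J ∈I) (a m ^ N)
    -- Here `N` must be positive, so that a factor `a m` can be split off the power.
    aᴺ∈J = ≡.subst (λ k → (J ∈I) (a m ^ k)) (ℕ.suc-pred N)
      (resp (*-comm (a m ^ pred N) (a m)) (*-closed (a m ^ pred N) a∈J))

  -- The difference is one of the factors of `a i`. With `a∉J` this keeps `X` distinct from its
  -- other conjugates in the residue field.
  X^pʲ-X∈J⇒aᵢ∈J : ∀ {j} i → 0 < j → j ≤ i → (J ∈I) (X ^p^ j - X) → (J ∈I) (a i)
  X^pʲ-X∈J⇒aᵢ∈J zero    0<j j≤0   h = contradiction j≤0 (ℕ.<⇒≱ 0<j)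
  X^pʲ-X∈J⇒aᵢ∈J (suc i) 0<j j≤1+i h with ℕ.m≤n⇒m<n∨m≡n j≤1+i
  ... | inj₁ j<1+i  = *-closed (X ^p^ suc i - X) (X^pʲ-X∈J⇒aᵢ∈J i 0<j (ℕ.≤-pred j<1+i) h)
  ... | inj₂ ≡.refl = resp (*-comm (a i) (X ^p^ suc i - X)) (*-closed (a i) h)

  F : Field 0ℓ 0ℓ
  F = residueField J (proj₂ (proj₂ maximal))

  F-hasCardinality : HasCardinality (Field.setoid F) q
  F-hasCardinality = FiniteField.Generator.hasCardinality F (λ f g → (f - g) ∈I?) pp (s≤s z≤n)
    (≡.subst (_~ 0#) (≡.sym (quotient-× p 1#)) (≈⇒~ p×1≈0))
    (λ f → ≡.subst (_~ f) (≡.sym (quotient-^ q f)) (≈⇒~ (f^q≈f f)))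
    X
    (λ {i} 0<i i<n X^pⁱ~X → a∉J (X^pʲ-X∈J⇒aᵢ∈J m 0<i (ℕ.≤-pred i<n)
      (≡.subst (_~ X) (quotient-^ (p ℕ.^ i) X) X^pⁱ~X)))

open import Data.Nat using (_^_)

theorem1p17 : (n p : ℕ) → n ≥ 1 → Prime p →
    Σ[ F ∈ Field 0ℓ 0ℓ ] HasCardinality (Field.setoid F) (p ^ n)
theorem1p17 (suc m) p _ pp = F , F-hasCardinality
  where open Construction p m pp
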